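{- A connected graph $G$ satisfies $\mathrm{vp}^-(G) = \mathrm{vp}(G) = 2$ if and only if $G$ is a cycle. Similarly, a connected graph $G$ satisfies $\mathrm{vp}(G) = 2$ only if $G$ is a cycle or a path of length at least $2$.
   Context: All graphs are finite, undirected and simple (so cycles have at least three vertices). A $u,v$-geodesic is a shortest $u,v$-path. For a vertex $x$ of $G$, a set $S \subseteq V(G)$ is an $x$-position set if for every $y \in S$ no vertex of $S \setminus \{y\}$ lies on any $x,y$-geodesic in $G$. The $x$-position number $p_x(G)$ is the maximum cardinality of an $x$-position set of $G$. Define $\mathrm{vp}(G) = \max_{x \in V(G)} p_x(G)$ and $\mathrm{vp}^-(G) = \min_{x \in V(G)} p_x(G)$. -}

module Defs where

open import Data.Empty using (⊥-elim)
open import Data.Fin using (Fin; zero; suc; toℕ)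
open import Data.Fin.Properties using (all?; injective⇒≤; toℕ<n) renaming (_≟_ to _≟ᶠ_)
open import Data.Fin.Subset using (Subset; _∈_; ∣_∣)
open import Data.Fin.Subset.Properties using (anySubset?; _∈?_)
open import Data.List using (List; []; _∷_; length; map; filter; upTo; allFin; head; last; lookup)
open import Data.List.Extrema.Nat using (max; min)
open import Data.List.Membership.Propositional using () renaming (_∉_ to _∉ˡ_)
open import Data.List.Membership.Propositional.Properties using (∈-lookup)
open import Data.List.Relation.Unary.All as All using ()
open import Data.List.Relation.Unary.AllPairs using (_∷_)
open import Data.List.Relation.Unary.Linked using (Linked; linked?)
open import Data.List.Relation.Unary.Unique.Propositional using (Unique)
open import Data.Maybe using (just)
open import Data.Maybe.Properties using (≡-dec)
open import Data.Nat using (ℕ; zero; suc; pred; _+_; _≤_; z≤n; s≤s; _≤?_; _%_; _≟_)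
open import Data.Nat.DivMod using (m<n⇒m%n≡m; n%n≡0)
open import Data.Nat.Properties using (m≤n⇒m<n∨m≡n; 1+n≢n; suc-injective)
open import Data.Product using (∃; _×_; _,_)
open import Data.Sum using (_⊎_; inj₁; inj₂; [_,_]; swap)
open import Function using (_∘_; _↔_; _⇔_; Inverse)
open import Level using (0ℓ)
open import Relation.Binary using (Rel; Decidable; Symmetric; Irreflexive)
open import Relation.Binary.PropositionalEquality using (_≡_; _≢_; refl; sym; trans; cong)
open import Relation.Nullary using (Dec)
open import Relation.Nullary.Decidable using (map′; _×-dec_; _⊎-dec_; _→-dec_; ¬?)
import Data.List.Membership.DecPropositional as DecMembership
import Data.List.Relation.Unary.Unique.DecPropositional as DecUnique
import Relation.Unary as U

record Graph (n : ℕ) : Set₁ where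
  field
    Adj        : Rel (Fin n) 0ℓ
    adj?       : Decidable Adj
    adj-sym    : Symmetric Adj
    adj-irrefl : Irreflexive _≡_ Adj

open Graph public

-- A path is given by the list of its vertices, in order, endpoints included.
record IsPath {n} (G : Graph n) (u v : Fin n) (vs : List (Fin n)) : Set where
  constructor isPath
  field
    starts   : head vs ≡ just u
    ends     : last vs ≡ just v
    adjacent : Linked (Adj G) vs
    distinct : Unique vs

pathLength : ∀ {n} → List (Fin n) → ℕ
pathLength vs = pred (length vs)

IsGeodesic : ∀ {n} → Graph n → (u v : Fin n) → List (Fin n) → Set
IsGeodesic G u v vs =
  IsPath G u v vs × (∀ ws → IsPath G u v ws → pathLength vs ≤ pathLength ws)

Connected : ∀ {n} → Graph n → Set
Connected G = ∀ u v → ∃ λ vs → IsPath G u v vs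

IsPositionSet : ∀ {n} → Graph n → Fin n → Subset n → Set
IsPositionSet G x S =
  ∀ y → y ∈ S → ∀ z → z ∈ S → z ≢ y → ∀ vs → IsGeodesic G x y vs → z ∉ˡ vs

isPath? : ∀ {n} (G : Graph n) u v → U.Decidable (IsPath G u v)
isPath? G u v vs =
  map′ (λ (a , b , c , d) → isPath a b c d)
       (λ q → IsPath.starts q , IsPath.ends q , IsPath.adjacent q , IsPath.distinct q)
       (≡-dec _≟ᶠ_ (head vs) (just u) ×-dec ≡-dec _≟ᶠ_ (last vs) (just v)
         ×-dec linked? (adj? G) vs ×-dec DecUnique.unique? _≟ᶠ_ vs)

unique⇒length≤ : ∀ {n} {vs : List (Fin n)} → Unique vs → length vs ≤ n
unique⇒length≤ un = injective⇒≤ (inj un)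
  where
  inj : ∀ {n} {vs : List (Fin n)} → Unique vs →
        ∀ {i j} → lookup vs i ≡ lookup vs j → i ≡ j
  inj (_ ∷ _)  {zero}  {zero}  _  = refl
  inj (a ∷ _)  {zero}  {suc j} eq = ⊥-elim (All.lookup a (∈-lookup j) eq)
  inj (a ∷ _)  {suc i} {zero}  eq = ⊥-elim (All.lookup a (∈-lookup i) (sym eq))
  inj (_ ∷ un) {suc i} {suc j} eq = cong suc (inj un eq)

allBounded? : ∀ {n} {P : List (Fin n) → Set} → U.Decidable P →
              ∀ m → Dec (∀ vs → length vs ≤ m → P vs)
allBounded? P? zero =
  map′ (λ { p [] _ → p }) (λ f → f [] z≤n) (P? [])
allBounded? P? (suc m) =
  map′ (λ { (p , _) [] _ → p ; (_ , f) (v ∷ vs) (s≤s le) → f v vs le })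
       (λ f → f [] z≤n , λ v vs le → f (v ∷ vs) (s≤s le))
       (P? [] ×-dec all? (λ v → allBounded? (P? ∘ (v ∷_)) m))

-- Paths have at most n vertices, so quantifying over them is a finite search.
allPaths? : ∀ {n} (G : Graph n) u v {P : List (Fin n) → Set} → U.Decidable P →
            Dec (∀ vs → IsPath G u v vs → P vs)
allPaths? {n} G u v P? =
  map′ (λ f vs q → f vs (unique⇒length≤ (IsPath.distinct q)) q)
       (λ f vs _ → f vs)
       (allBounded? (λ vs → isPath? G u v vs →-dec P? vs) n)

isGeodesic? : ∀ {n} (G : Graph n) u v → U.Decidable (IsGeodesic G u v)
isGeodesic? G u v vs =
  isPath? G u v vs ×-dec allPaths? G u v (λ ws → pathLength vs ≤? pathLength ws)

isPositionSet? : ∀ {n} (G : Graph n) x → U.Decidable (IsPositionSet G x)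
isPositionSet? G x S =
  all? λ y → (y ∈? S) →-dec all? λ z → (z ∈? S) →-dec (¬? (z ≟ᶠ y) →-dec
    map′ (λ f vs (q , s) → f vs q s) (λ f vs q s → f vs (q , s))
      (allPaths? G x y λ vs →
        allPaths? G x y (λ ws → pathLength vs ≤? pathLength ws) →-dec
        ¬? (DecMembership._∈?_ _≟ᶠ_ z vs)))

HasPositionSetOfSize : ∀ {n} → Graph n → Fin n → ℕ → Set
HasPositionSetOfSize G x k = ∃ λ S → IsPositionSet G x S × ∣ S ∣ ≡ k

hasPositionSetOfSize? : ∀ {n} (G : Graph n) x → U.Decidable (HasPositionSetOfSize G x)
hasPositionSetOfSize? G x k = anySubset? λ S → isPositionSet? G x S ×-dec (∣ S ∣ ≟ k)

-- The default value 0 is attained by the empty position set.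
p : ∀ {n} → Graph n → Fin n → ℕ
p {n} G x = max 0 (filter (hasPositionSetOfSize? G x) (upTo (suc n)))

-- vp and vp⁻ range over the vertices of a nonempty graph; the default
-- value p G zero is itself one of the values being compared.
vp : ∀ {n} → Graph (suc n) → ℕ
vp G = max (p G zero) (map (p G) (allFin _))

vp⁻ : ∀ {n} → Graph (suc n) → ℕ
vp⁻ G = min (p G zero) (map (p G) (allFin _))

record _≅_ {m n} (G : Graph m) (H : Graph n) : Set where
  field
    bijection : Fin m ↔ Fin n
    adjacency : ∀ u v → Adj G u v ⇔ Adj H (Inverse.to bijection u) (Inverse.to bijection v)

-- The path of length ℓ, on vertices 0, 1, …, ℓ.
pathGraph : ∀ ℓ → Graph (suc ℓ)
pathGraph ℓ = record
  { Adj        = λ i j → suc (toℕ i) ≡ toℕ j ⊎ suc (toℕ j) ≡ toℕ i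
  ; adj?       = λ i j → (suc (toℕ i) ≟ toℕ j) ⊎-dec (suc (toℕ j) ≟ toℕ i)
  ; adj-sym    = swap
  ; adj-irrefl = λ { refl → [ 1+n≢n , 1+n≢n ] }
  }

-- The cycle on 3 + m vertices, the least possible number being 3.
cycleGraph : ∀ m → Graph (3 + m)
cycleGraph m = record
  { Adj        = λ i j → next i ≡ toℕ j ⊎ next j ≡ toℕ i
  ; adj?       = λ i j → (next i ≟ toℕ j) ⊎-dec (next j ≟ toℕ i)
  ; adj-sym    = swap
  ; adj-irrefl = λ { {i} refl → [ next≢ i , next≢ i ] }
  }
  where
  next : Fin (3 + m) → ℕ
  next i = suc (toℕ i) % (3 + m)

  next≢ : ∀ i → next i ≢ toℕ i
  next≢ i eq with m≤n⇒m<n∨m≡n (toℕ<n i)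
  ... | inj₁ lt = 1+n≢n (trans (sym (m<n⇒m%n≡m lt)) eq)
  ... | inj₂ e with trans (sym eq) (trans (cong (_% (3 + m)) e) (n%n≡0 (3 + m)))
  ...   | i≡0 with trans (sym i≡0) (suc-injective e)
  ...     | ()

IsCycle : ∀ {n} → Graph n → Set
IsCycle G = ∃ λ m → G ≅ cycleGraph m

IsPathOfLength≥2 : ∀ {n} → Graph n → Set
IsPathOfLength≥2 G = ∃ λ ℓ → 2 ≤ ℓ × G ≅ pathGraph ℓ

{-# OPTIONS --safe #-}

-- The neighbours of x form an x-position set, so vp G ≡ 2 bounds all degrees by two.
-- Conversely, if all degrees are at most two, paths cannot branch: of two geodesics
-- from x with the same first edge one is a prefix of the other.  Hence geodesics to distinct
-- elements of an x-position set start along distinct edges, and p G x is the degree of x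
-- (or 1 if G is a single vertex).
-- A connected graph of maximum degree two is covered by any maximal path f 0, …, f ℓ,
-- and the only possible further edge joins f 0 and f ℓ.

module Submission where

open import Defs
open import Data.Fin using (Fin; zero; suc; toℕ; fromℕ<; fromℕ; inject₁)
open import Data.Fin.Properties
  using (injective⇒≤; sequence; any?; toℕ-injective; toℕ-fromℕ<; toℕ-fromℕ; toℕ-inject₁
       ; toℕ<n; toℕ≤pred[n])
  renaming (_≟_ to _≟ᶠ_; suc-injective to sucᶠ-injective; 0≢1+n to 0≢1+nᶠ)
open import Data.Fin.Subset
  using (Subset; _∈_; _∉_; ∣_∣; inside; outside)
  renaming (⊥ to ∅)
open import Data.Fin.Subset.Properties using (∉⊥; ∣⊥∣≡0; ∣p∣≤n)
open import Data.List using ([]; _∷_; last; filter; upTo; map; allFin; head)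
open import Data.List.Extrema.Nat using (max≤v⁺; xs≤max; min≤xs; v≤min⁺)
open import Data.List.Membership.Propositional using () renaming (_∈_ to _∈ˡ_)
open import Data.List.Membership.Propositional.Properties
  using (∈-filter⁺; ∈-upTo⁺; ∈-map⁺; ∈-allFin)
open import Data.List.Relation.Unary.All as All using ([]; _∷_)
open import Data.List.Relation.Unary.All.Properties
  using (all-filter)
  renaming (map⁺ to All-map⁺)
open import Data.List.Relation.Unary.AllPairs using ([]; _∷_)
open import Data.List.Relation.Unary.Any using (here; there)
open import Data.List.Relation.Unary.Linked using (Linked; [-]; _∷_)
open import Data.List.Relation.Unary.Unique.Propositional using (Unique)
open import Data.Maybe using (just)
open import Data.Nat using (ℕ; zero; suc; _+_; _≤_; _<_; _≤?_; z≤n; s≤s; _∸_; _%_)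
open import Data.Nat.DivMod using (m<n⇒m%n≡m; n%n≡0; m%n<n)
open import Data.Nat.Properties
  using (≤-trans; ≤-refl; ≤-reflexive; ≮⇒≥; ≰⇒>; ≤-antisym; <⇒≤; <⇒≢; <⇒≱; <-irrefl
       ; <-trans; n<1+n; n≤1+n; m≢1+n+m; m≤n⇒m<n∨m≡n; <-cmp; m∸n≤m; ∸-monoʳ-<
       ; ∸-cancelˡ-≡; +-∸-assoc; +-suc; m≤m+n; suc-injective)
open import Data.Product using (∃; _×_; _,_; proj₁; proj₂; ∃₂)
open import Data.Sum as Sum using (_⊎_; inj₁; inj₂)
open import Data.Vec as Vec using ([]; _∷_; _[_]≔_)
open import Data.Vec.Properties using (lookup∘update′; []=⇒lookup; lookup⇒[]=)
open import Data.Vec.Relation.Unary.All as VAll using ([]; _∷_)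
open import Data.Vec.Relation.Unary.All.Properties using (lookup⁺)
open import Data.Vec.Relation.Unary.AllPairs using ([]; _∷_)
open import Data.Vec.Relation.Unary.Unique.Propositional
  using ()
  renaming (Unique to Uniqueᵛ)
open import Data.Vec.Relation.Unary.Unique.Propositional.Properties
  using (lookup-injective)
open import Effect.Monad using (RawMonad)
open import Function
  using (_∘_; Injective; _⇔_; mk⇔; mk↔ₛ′; Injection; Inverse; Equivalence)
open import Function.Properties.Equivalence using () renaming (sym to ⇔-sym)
open import Function.Properties.Inverse using (↔-sym; ↔⇒↣)
open import Relation.Binary using (tri<; tri≈; tri>)
open import Relation.Binary.PropositionalEquality
  using (_≡_; _≢_; refl; sym; trans; cong; subst; ≢-sym; subst₂)
open import Relation.Nullary using (¬_; yes; no; contradiction; decidable-stable; Dec)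
open import Relation.Nullary.Decidable using (_×-dec_; ¬?; decidable-stable)
open import Relation.Nullary.Negation using (¬¬-Monad; ¬¬-map)

private variable
  n k d m : ℕ
  G H : Graph n
  u v w x y z a b c : Fin n

-- Subsets and injective families.

insert-∣∣ : (S : Subset n) → a ∉ S → ∣ S [ a ]≔ inside ∣ ≡ suc ∣ S ∣
insert-∣∣ {a = zero}  (inside  ∷ S) a∉S = contradiction Vec.here a∉S
insert-∣∣ {a = zero}  (outside ∷ S) a∉S = refl
insert-∣∣ {a = suc a} (inside  ∷ S) a∉S = cong suc (insert-∣∣ S (a∉S ∘ Vec.there))
insert-∣∣ {a = suc a} (outside ∷ S) a∉S = insert-∣∣ S (a∉S ∘ Vec.there)

∈-insert⁻ : (S : Subset n) → y ∈ S [ a ]≔ inside → y ≡ a ⊎ y ∈ S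
∈-insert⁻ {y = y} {a = a} S y∈ with y ≟ᶠ a
... | yes y≡a = inj₁ y≡a
... | no  y≢a = inj₂ (lookup⇒[]= y S
                  (trans (sym (lookup∘update′ y≢a S inside)) ([]=⇒lookup y∈)))

-- Turns a family of distinct vertices into a `Subset` of known size, the form in which `p` counts
-- position sets.
range : (f : Fin k → Fin n) → Injective _≡_ _≡_ f →
        ∃ λ S → ∣ S ∣ ≡ k × (∀ {y} → y ∈ S → ∃ λ i → y ≡ f i)
range {zero}  {n} f f-inj = ∅ , ∣⊥∣≡0 n , λ y∈∅ → contradiction y∈∅ ∉⊥
range {suc k} f f-inj
  with S , ∣S∣≡k , S⊆ ← range (f ∘ suc) (sucᶠ-injective ∘ f-inj)
  = S [ f zero ]≔ inside
  , trans (insert-∣∣ S f0∉S) (cong suc ∣S∣≡k)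
  , λ y∈ → Sum.[ (λ y≡f0 → zero , y≡f0)
               , (λ y∈S → let i , y≡fi = S⊆ y∈S in suc i , y≡fi)
               ] (∈-insert⁻ S y∈)
  where
  f0∉S : f zero ∉ S
  f0∉S f0∈S = 0≢1+nᶠ (f-inj (proj₂ (S⊆ f0∈S)))

enumerate : (S : Subset n) → Fin ∣ S ∣ → Fin n
enumerate (inside  ∷ S) zero    = zero
enumerate (inside  ∷ S) (suc i) = suc (enumerate S i)
enumerate (outside ∷ S) i       = suc (enumerate S i)

enumerate-∈ : (S : Subset n) → ∀ i → enumerate S i ∈ S
enumerate-∈ (inside  ∷ S) zero    = Vec.here
enumerate-∈ (inside  ∷ S) (suc i) = Vec.there (enumerate-∈ S i)
enumerate-∈ (outside ∷ S) i       = Vec.there (enumerate-∈ S i)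

enumerate-injective : (S : Subset n) → Injective _≡_ _≡_ (enumerate S)
enumerate-injective (inside  ∷ S) {zero}  {zero}  eq = refl
enumerate-injective (inside  ∷ S) {suc i} {suc j} eq =
  cong suc (enumerate-injective S (sucᶠ-injective eq))
enumerate-injective (outside ∷ S) eq = enumerate-injective S (sucᶠ-injective eq)

-- Neighbours and degrees.

record Neighbours (G : Graph n) (x : Fin n) (k : ℕ) : Set where
  field
    vertex    : Fin k → Fin n
    injective : Injective _≡_ _≡_ vertex
    adjacent  : ∀ i → Adj G x (vertex i)

-- Bounding the size of injective families of neighbours avoids counting a neighbour set.
Degree≤ : Graph n → Fin n → ℕ → Set
Degree≤ G x d = ∀ {k} → Neighbours G x k → k ≤ d

neighbours : {vs : Vec.Vec (Fin n) k} → Uniqueᵛ vs → VAll.All (Adj G x) vs → Neighbours G x k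
neighbours {vs = vs} un adj = record
  { vertex    = Vec.lookup vs
  ; injective = lookup-injective un _ _
  ; adjacent  = λ i → lookup⁺ adj i
  }

third-neighbour : Degree≤ G x 2 → Adj G x a → Adj G x b → Adj G x c → a ≢ b → c ≡ a ⊎ c ≡ b
third-neighbour {a = a} {b = b} {c = c} deg xa xb xc a≢b with c ≟ᶠ a | c ≟ᶠ b
... | yes c≡a | _       = inj₁ c≡a
... | no  _   | yes c≡b = inj₂ c≡b
... | no  c≢a | no  c≢b with s≤s (s≤s ()) ← deg (neighbours
  ((c≢a ∷ c≢b ∷ []) ∷ (a≢b ∷ []) ∷ [] ∷ []) (xc ∷ xa ∷ xb ∷ []))

-- The degree as a lower bound for the position number.

p≤ : (G : Graph n) (x : Fin n) → (∀ S → IsPositionSet G x S → ∣ S ∣ ≤ d) → p G x ≤ d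
p≤ {n} G x bound = max≤v⁺ {xs = filter (hasPositionSetOfSize? G x) (upTo (suc n))} z≤n
  (All.map (λ (S , pos , ∣S∣≡k) → ≤-trans (≤-reflexive (sym ∣S∣≡k)) (bound S pos))
           (all-filter (hasPositionSetOfSize? G x) (upTo (suc n))))

∣∣≤p : (G : Graph n) (x : Fin n) (S : Subset n) → IsPositionSet G x S → ∣ S ∣ ≤ p G x
∣∣≤p G x S pos = All.lookup (xs≤max 0 _)
  (∈-filter⁺ (hasPositionSetOfSize? G x) (∈-upTo⁺ (s≤s (∣p∣≤n S))) (S , pos , refl))

-- The edge itself is a path of length 1, so a geodesic has no room for a third vertex.
edge-geodesic : ∀ {vs} → Adj G x y → IsGeodesic G x y vs → z ∈ˡ vs → z ≡ x ⊎ z ≡ y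
edge-geodesic {vs = _ ∷ []} xy (isPath refl _ _ _ , _) (here z≡x) = inj₁ z≡x
edge-geodesic {vs = _ ∷ _ ∷ []} xy (isPath refl _ _ _ , _) (here z≡x) = inj₁ z≡x
edge-geodesic {vs = _ ∷ _ ∷ []} xy (isPath _ refl _ _ , _) (there (here z≡y)) = inj₂ z≡y
edge-geodesic {G = G} {x = x} {y = y} {vs = _ ∷ _ ∷ _ ∷ _} xy (_ , shortest) z∈vs
  with s≤s () ← shortest (x ∷ y ∷ [])
    (isPath refl refl (xy ∷ [-])
      (((λ x≡y → adj-irrefl G x≡y xy) ∷ []) ∷ [] ∷ []))

-- A geodesic from `x` to a neighbour contains only its two ends, and `x` is not its own neighbour,
-- so no other neighbour lies on it.
degree≤p : Neighbours G x k → k ≤ p G x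
degree≤p {G = G} {x = x} nb
  with S , refl , S⊆ ← range (Neighbours.vertex nb) (Neighbours.injective nb)
  = ∣∣≤p G x S pos
  where
  open Neighbours nb

  x~ : y ∈ S → Adj G x y
  x~ y∈S = subst (Adj G x) (sym (proj₂ (S⊆ y∈S))) (adjacent _)

  pos : IsPositionSet G x S
  pos y y∈S z z∈S z≢y vs geo z∈vs =
    Sum.[ (λ z≡x → adj-irrefl G (sym z≡x) (x~ z∈S)) , z≢y ] (edge-geodesic (x~ y∈S) geo z∈vs)

-- The degree as an upper bound when all degrees are at most two.

head-∈ : ∀ {vs} → IsPath G x y vs → x ∈ˡ vs
head-∈ {vs = _ ∷ _} (isPath refl _ _ _) = here refl

-- Double negation costs nothing here: it is only used towards decidable goals.
¬¬geodesic : Connected G → ∀ u v → ¬ ¬ ∃ (IsGeodesic G u v)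
¬¬geodesic {G = G} connected u v none =
  let vs , path = connected u v in noShorter (suc (pathLength vs)) vs path ≤-refl
  where
  -- Induction on `m`: if no path is shorter than `m`, a path of length at most `m` is a geodesic,
  -- against `none`.
  noShorter : ∀ m vs → IsPath G u v vs → ¬ (pathLength vs < m)
  noShorter (suc m) vs path (s≤s le) = none (vs , path , λ ws path′ →
    ≮⇒≥ (λ lt → noShorter m ws path′ (≤-trans lt le)))

FirstStep : Graph n → Fin n → Fin n → Fin n → Set
FirstStep G x y a = ∃ λ vs → IsGeodesic G x y (x ∷ a ∷ vs)

firstStep : x ≢ y → ∃ (IsGeodesic G x y) → ∃ λ a → Adj G x a × FirstStep G x y a
firstStep x≢y (_ ∷ [] , isPath refl refl _ _ , _) = contradiction refl x≢y
firstStep x≢y (_ ∷ a ∷ vs , geo@(isPath refl _ (xa ∷ _) _ , _)) = a , xa , vs , geo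

-- After the common edge, each path must leave `a` by a neighbour other than `x`. There is at most
-- one, so the paths agree until one of them ends, and that endpoint lies on the other.
one-prefix : (∀ x → Degree≤ G x 2) → ∀ {vs ws} →
             Linked (Adj G) (x ∷ a ∷ vs) → Unique (x ∷ a ∷ vs) →
             Linked (Adj G) (x ∷ a ∷ ws) → Unique (x ∷ a ∷ ws) →
             last (a ∷ vs) ≡ just y → last (a ∷ ws) ≡ just z →
             z ∈ˡ a ∷ vs ⊎ y ∈ˡ a ∷ ws
one-prefix deg {vs = []}    _ _ _ _ refl _ = inj₂ (here refl)
one-prefix deg {vs = _ ∷ _} {ws = []} _ _ _ _ _ refl = inj₁ (here refl)
one-prefix {G = G} deg {vs = b ∷ vs} {ws = c ∷ ws}
  (xa ∷ l@(ab ∷ _)) ((_ ∷ x≢b ∷ _) ∷ un) (_ ∷ l′@(ac ∷ _)) ((_ ∷ x≢c ∷ _) ∷ un′) y-last z-last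
  with third-neighbour (deg _) (adj-sym G xa) ab ac x≢b
... | inj₁ c≡x  = contradiction (sym c≡x) x≢c
... | inj₂ refl = Sum.map there there (one-prefix deg l un l′ un′ y-last z-last)

-- If `y ≢ z`, then `one-prefix` puts one of them on a geodesic to the other, against `pos`.
firstStep-injective : (∀ x → Degree≤ G x 2) → ∀ {S} → IsPositionSet G x S →
                      y ∈ S → z ∈ S → FirstStep G x y a → FirstStep G x z a → y ≡ z
firstStep-injective {y = y} {z = z} deg pos y∈S z∈S
  (_ , geo@(isPath _ ends l un , _)) (_ , geo′@(isPath _ ends′ l′ un′ , _)) =
  decidable-stable (y ≟ᶠ z) λ y≢z →
    Sum.[ pos y y∈S z z∈S (≢-sym y≢z) _ geo ∘ there , pos z z∈S y y∈S y≢z _ geo′ ∘ there ]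
      (one-prefix deg l un l′ un′ ends ends′)

-- First vertices of geodesics to the elements `e i` form a family of distinct neighbours of `x`.
-- The bound `1 ≤ d` serves `k = 1`, where the only element may be `x` itself and has no first edge.
position-bound : Connected G → (∀ x → Degree≤ G x 2) → ∀ {S} → IsPositionSet G x S →
                 (e : Fin k → Fin n) → Injective _≡_ _≡_ e → (∀ i → e i ∈ S) →
                 Degree≤ G x d → 1 ≤ d → k ≤ d
position-bound {k = 0} _ _ _ _ _ _ _ _ = z≤n
position-bound {k = 1} _ _ _ _ _ _ _ 1≤d = 1≤d
position-bound {G = G} {x = x} {k = suc (suc k)} {d = d} connected deg pos e e-inj e∈S deg-x _ =
  decidable-stable (suc (suc k) ≤? d)
    (¬¬-map (λ steps → deg-x record
      { vertex    = proj₁ ∘ steps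
      ; injective = λ {i} {j} eq → e-inj
          (firstStep-injective deg pos (e∈S i) (e∈S j) (proj₂ (proj₂ (steps i)))
            (subst (FirstStep G x _) (sym eq) (proj₂ (proj₂ (steps j)))))
      ; adjacent  = proj₁ ∘ proj₂ ∘ steps
      })
    -- The family is finite, so the double negations of the separate choices combine into one.
    (sequence (RawMonad.rawApplicative ¬¬-Monad)
      (λ i → ¬¬-map (firstStep (x≢e i)) (¬¬geodesic connected x (e i)))))
  where
  other : Fin (suc (suc k)) → Fin (suc (suc k))
  other zero    = suc zero
  other (suc _) = zero

  other-≢ : ∀ i → i ≢ other i
  other-≢ zero    ()
  other-≢ (suc _) ()

  -- Every geodesic from `x` contains `x`; if `e i` were `x`, it would lie on a geodesic to
  -- `e (other i)`.
  x≢e : ∀ i → x ≢ e i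
  x≢e i refl = ¬¬geodesic connected x (e (other i)) λ (vs , geo) →
    pos _ (e∈S (other i)) x (e∈S i) (other-≢ i ∘ e-inj) vs geo (head-∈ (proj₁ geo))

p≤degree : Connected G → (∀ x → Degree≤ G x 2) → Degree≤ G x d → 1 ≤ d → p G x ≤ d
p≤degree {G = G} {x = x} connected deg deg-x 1≤d = p≤ G x λ S pos →
  position-bound connected deg pos (enumerate S) (enumerate-injective S) (enumerate-∈ S) deg-x 1≤d

-- Maximal paths.

-- The path f 0, …, f m; the values of f beyond m are irrelevant.
record Trace (G : Graph n) (m : ℕ) (f : ℕ → Fin n) : Set where
  field
    step      : ∀ {i} → i < m → Adj G (f i) (f (suc i))
    injective : ∀ {i j} → i ≤ m → j ≤ m → f i ≡ f j → i ≡ j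

-- The index lies in `Fin (suc m)` so that `any?` decides membership and `isomorphic` can read off
-- its bijection.
OnTrace : ℕ → (ℕ → Fin n) → Fin n → Set
OnTrace m f w = ∃ λ (i : Fin (suc m)) → f (toℕ i) ≡ w

onTrace : (f : ℕ → Fin n) → ∀ {i} → i ≤ m → OnTrace m f (f i)
onTrace f i≤m = fromℕ< (s≤s i≤m) , cong f (toℕ-fromℕ< (s≤s i≤m))

Closed : Graph n → ℕ → (ℕ → Fin n) → Fin n → Set
Closed G m f v = ∀ {w} → Adj G v w → OnTrace m f w

trace-length : {f : ℕ → Fin n} → Trace G m f → m < n
trace-length {f = f} t = injective⇒≤ {f = f ∘ toℕ}
  (toℕ-injective ∘ Trace.injective t (toℕ≤pred[n] _) (toℕ≤pred[n] _))

-- Traces are extended at the front only; reversal brings the far end there.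
reverse : ℕ → (ℕ → Fin n) → ℕ → Fin n
reverse m f i = f (m ∸ i)

reverse-trace : {f : ℕ → Fin n} → Trace G m f → Trace G m (reverse m f)
reverse-trace {G = G} {m = m} {f = f} t = record
  { step = λ {i} i<m → adj-sym G
      -- The equation is `m ∸ i ≡ suc (m ∸ suc i)`; below, `o = 0` makes the bound `m ∸ 0` compute
      -- to `m`.
      (subst (λ j → Adj G (f (m ∸ suc i)) (f j)) (sym (+-∸-assoc 1 i<m))
        (step (∸-monoʳ-< {o = 0} (s≤s z≤n) i<m)))
  ; injective = λ {i} {j} i≤m j≤m →
      ∸-cancelˡ-≡ i≤m j≤m ∘ injective (m∸n≤m m i) (m∸n≤m m j)
  }
  where open Trace t

reverse-onTrace : {f : ℕ → Fin n} → OnTrace m (reverse m f) w → OnTrace m f w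
reverse-onTrace {m = m} {f = f} (i , refl) = onTrace f (m∸n≤m m (toℕ i))

cons : Fin n → (ℕ → Fin n) → ℕ → Fin n
cons w f zero    = w
cons w f (suc i) = f i

cons-trace : {f : ℕ → Fin n} → Trace G m f → Adj G (f 0) w → ¬ OnTrace m f w →
             Trace G (suc m) (cons w f)
cons-trace {G = G} {f = f} t f0~w w∉ = record
  { step      = λ { {zero} _ → adj-sym G f0~w ; {suc i} (s≤s i<m) → step i<m }
  ; injective = λ
      { {zero}  {zero}  _ _ _              → refl
      ; {zero}  {suc j} _ (s≤s j≤m) w≡fj   →
          contradiction (subst (OnTrace _ f) (sym w≡fj) (onTrace f j≤m)) w∉
      ; {suc i} {zero}  (s≤s i≤m) _ fi≡w   →
          contradiction (subst (OnTrace _ f) fi≡w (onTrace f i≤m)) w∉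
      ; {suc i} {suc j} (s≤s i≤m) (s≤s j≤m) → cong suc ∘ injective i≤m j≤m
      }
  }
  where open Trace t

onTrace? : (m : ℕ) (f : ℕ → Fin n) (w : Fin n) → Dec (OnTrace m f w)
onTrace? m f w = any? (λ i → f (toℕ i) ≟ᶠ w)

extend? : {f : ℕ → Fin n} → Trace G m f →
          (∃ λ w → Trace G (suc m) (cons w f)) ⊎ Closed G m f (f 0)
extend? {G = G} {m = m} {f = f} t
  with any? (λ w → adj? G (f 0) w ×-dec ¬? (onTrace? m f w))
... | yes (w , f0~w , w∉) = inj₁ (w , cons-trace t f0~w w∉)
... | no  stuck = inj₂ λ {w} f0~w →
        decidable-stable (onTrace? m f w) (λ w∉ → stuck (w , f0~w , w∉))

record MaximalTrace (G : Graph n) (m : ℕ) (f : ℕ → Fin n) : Set where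
  field
    trace : Trace G m f
    start : Closed G m f (f 0)
    end   : Closed G m f (f m)

-- Each extension moves one unit from `fuel` to the length, preserving `n ≤ fuel + m`; with no fuel
-- left this contradicts `trace-length`.
maximal : ∀ fuel {f : ℕ → Fin n} → Trace G m f → n ≤ fuel + m → ∃₂ (MaximalTrace G)
maximal zero t n≤m = contradiction (≤-trans (trace-length t) n≤m) (<-irrefl refl)
maximal {m = m} (suc fuel) {f} t n≤ with extend? t | extend? (reverse-trace t)
... | inj₁ (_ , t′) | _ = maximal fuel t′ (≤-trans n≤ (≤-reflexive (sym (+-suc fuel m))))
... | inj₂ _ | inj₁ (_ , t′) = maximal fuel t′ (≤-trans n≤ (≤-reflexive (sym (+-suc fuel m))))
... | inj₂ closed | inj₂ closed′ = _ , _ , record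
  -- `reverse m f 0` computes to `f m`, so `closed′` concerns the far end.
  { trace = t ; start = closed ; end = reverse-onTrace {f = f} ∘ closed′ }

∃maximal : (G : Graph (suc n)) → ∃₂ (MaximalTrace G)
∃maximal {n} G = maximal (suc n) {f = λ _ → zero}
  (record { step = λ () ; injective = λ { z≤n z≤n _ → refl } })
  (m≤m+n (suc n) 0)

-- A maximal path in a connected graph of maximum degree two.

module _ {G : Graph n} (connected : Connected G) (deg : ∀ x → Degree≤ G x 2)
         {ℓ : ℕ} {f : ℕ → Fin n} (max : MaximalTrace G ℓ f) where
  open MaximalTrace max
  open Trace trace

  -- The two neighbours along the trace are distinct and exhaust the degree.
  interior : ∀ {i} → suc i < ℓ → Adj G (f (suc i)) w → w ≡ f i ⊎ w ≡ f (2 + i)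
  interior {i = i} 1+i<ℓ ~w =
    third-neighbour (deg _) (adj-sym G (step i<ℓ)) (step 1+i<ℓ) ~w
      (λ eq → m≢1+n+m i (injective (<⇒≤ i<ℓ) 1+i<ℓ eq))
    where
    i<ℓ = <⇒≤ 1+i<ℓ

  closed : ∀ {i} → i ≤ ℓ → Closed G ℓ f (f i)
  closed {zero}  _ = start
  closed {suc i} i≤ℓ ~w with m≤n⇒m<n∨m≡n i≤ℓ
  ... | inj₂ refl = end ~w
  ... | inj₁ i<ℓ with interior i<ℓ ~w
  ...   | inj₁ refl = onTrace f (<⇒≤ i≤ℓ)
  ...   | inj₂ refl = onTrace f i<ℓ

  -- The trace contains `f 0` and, by `closed`, every neighbour of its vertices, so a path from
  -- `f 0` to `w` never leaves it.
  spanning : ∀ w → OnTrace ℓ f w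
  spanning w with isPath starts ends linked _ ← proj₂ (connected (f 0) w)
    = follow _ starts ends linked (onTrace f z≤n)
    where
    follow : ∀ vs → head vs ≡ just u → last vs ≡ just v → Linked (Adj G) vs →
             OnTrace ℓ f u → OnTrace ℓ f v
    follow (_ ∷ [])     refl refl _         u∈ = u∈
    follow (_ ∷ v ∷ vs) refl ends (uv ∷ l) (i , refl) =
      follow (v ∷ vs) refl ends l (closed (toℕ≤pred[n] i) uv)

  -- If `i` is positive, then `f i` is interior; if `i` is 0, then `f j` is interior unless `j` is
  -- `ℓ`.
  chord : ∀ {i j} → i < j → j ≤ ℓ → Adj G (f i) (f j) → suc i ≡ j ⊎ (i ≡ 0 × j ≡ ℓ)
  chord {suc i} {j} i<j j≤ℓ ~ with interior (≤-trans i<j j≤ℓ) ~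
  ... | inj₁ eq = contradiction (injective j≤ℓ (≤-trans (n≤1+n i) (≤-trans (<⇒≤ i<j) j≤ℓ)) eq)
                    (λ { refl → <-irrefl refl (<-trans i<j (n<1+n i)) })
  ... | inj₂ eq = inj₁ (sym (injective j≤ℓ (≤-trans i<j j≤ℓ) eq))
  chord {zero} {suc j} i<j j≤ℓ ~ with m≤n⇒m<n∨m≡n j≤ℓ
  ... | inj₂ j≡ℓ = inj₂ (refl , j≡ℓ)
  ... | inj₁ j<ℓ with interior j<ℓ (adj-sym G ~)
  ...   | inj₁ eq = inj₁ (cong suc (injective z≤n (<⇒≤ j≤ℓ) eq))
  ...   | inj₂ eq = contradiction (injective z≤n j<ℓ eq) λ ()

  -- `f ∘ toℕ` is injective because the trace is, and onto by `spanning`; adjacency can thus be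
  -- compared on indices.
  isomorphic : (H : Graph (suc ℓ)) →
               (∀ i j → Adj G (f (toℕ i)) (f (toℕ j)) ⇔ Adj H i j) → G ≅ H
  isomorphic H adj⇔ = record
    { bijection = mk↔ₛ′ index (f ∘ toℕ)
        (λ i → toℕ-injective (injective (toℕ≤pred[n] _) (toℕ≤pred[n] i) (f-index (f (toℕ i)))))
        f-index
    ; adjacency = λ u v → subst₂ (λ u′ v′ → Adj G u′ v′ ⇔ Adj H (index u) (index v))
        (f-index u) (f-index v) (adj⇔ (index u) (index v))
    }
    where
    index : Fin n → Fin (suc ℓ)
    index = proj₁ ∘ spanning

    f-index : ∀ v → f (toℕ (index v)) ≡ v
    f-index = proj₂ ∘ spanning

-- Recognising cycles and paths.

-- Successor modulo `3 + m` for numbers below `3 + m`, with the wrap-around as a case of its own.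
CycleSuc : ℕ → ℕ → ℕ → Set
CycleSuc m i j = suc i ≡ j ⊎ (i ≡ 2 + m × j ≡ 0)

module _ {m i j : ℕ} where
  next⇒cycleSuc : i < 3 + m → suc i % (3 + m) ≡ j → CycleSuc m i j
  next⇒cycleSuc (s≤s i≤) eq with m≤n⇒m<n∨m≡n i≤
  ... | inj₁ i< = inj₁ (trans (sym (m<n⇒m%n≡m (s≤s i<))) eq)
  ... | inj₂ refl = inj₂ (refl , trans (sym eq) (n%n≡0 (3 + m)))

  cycleSuc⇒next : j < 3 + m → CycleSuc m i j → suc i % (3 + m) ≡ j
  cycleSuc⇒next j< (inj₁ refl)          = m<n⇒m%n≡m j<
  cycleSuc⇒next j< (inj₂ (refl , refl)) = n%n≡0 (3 + m)

module _ {G : Graph n} (connected : Connected G) (deg : ∀ x → Degree≤ G x 2) where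

  -- By `chord`, `closing` is the only edge besides the steps of the trace.
  cyclic : {f : ℕ → Fin n} → MaximalTrace G (2 + m) f → Adj G (f 0) (f (2 + m)) → G ≅ cycleGraph m
  cyclic {m = m} {f = f} max closing =
    isomorphic connected deg max (cycleGraph m) (λ i j → mk⇔ (to i j) (from i j))
    where
    open MaximalTrace max using (trace)

    ascending : ∀ i j → toℕ i < toℕ j → Adj G (f (toℕ i)) (f (toℕ j)) → Adj (cycleGraph m) i j
    ascending i j i<j fi~fj with chord connected deg max i<j (toℕ≤pred[n] j) fi~fj
    ... | inj₁ 1+i≡j       = inj₁ (cycleSuc⇒next (toℕ<n j) (inj₁ 1+i≡j))
    -- The wrap-around runs from the larger index `j` to `i`, hence the swapped side.
    ... | inj₂ (i≡0 , j≡ℓ) = inj₂ (cycleSuc⇒next (toℕ<n i) (inj₂ (j≡ℓ , i≡0)))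

    to : ∀ i j → Adj G (f (toℕ i)) (f (toℕ j)) → Adj (cycleGraph m) i j
    to i j fi~fj with <-cmp (toℕ i) (toℕ j)
    ... | tri< i<j _ _ = ascending i j i<j fi~fj
    ... | tri≈ _ i≡j _ = contradiction fi~fj (adj-irrefl G (cong f i≡j))
    ... | tri> _ _ j<i = Sum.swap (ascending j i j<i (adj-sym G fi~fj))

    arc : ∀ {i j} → j < 3 + m → CycleSuc m i j → Adj G (f i) (f j)
    arc (s≤s j≤ℓ) (inj₁ refl)          = Trace.step trace j≤ℓ
    arc _         (inj₂ (refl , refl)) = adj-sym G closing

    from : ∀ i j → Adj (cycleGraph m) i j → Adj G (f (toℕ i)) (f (toℕ j))
    from i j (inj₁ e) = arc (toℕ<n j) (next⇒cycleSuc (toℕ<n i) e)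
    from i j (inj₂ e) = adj-sym G (arc (toℕ<n i) (next⇒cycleSuc (toℕ<n j) e))

  -- Adjacent ends are excluded only together with `2 ≤ m`: for `m = 1` they are joined by the trace
  -- itself.
  linear : {f : ℕ → Fin n} → MaximalTrace G m f → ¬ (2 ≤ m × Adj G (f 0) (f m)) → G ≅ pathGraph m
  linear {m = m} {f = f} max open-ended =
    isomorphic connected deg max (pathGraph m) (λ i j → mk⇔ (to i j) (from i j))
    where
    open MaximalTrace max using (trace)

    ascending : ∀ {i j} → i < j → j ≤ m → Adj G (f i) (f j) → suc i ≡ j
    ascending i<j j≤m fi~fj with chord connected deg max i<j j≤m fi~fj
    ... | inj₁ 1+i≡j         = 1+i≡j
    ... | inj₂ (refl , refl) = ≤-antisym i<j (≮⇒≥ λ 2≤m → open-ended (2≤m , fi~fj))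

    to : ∀ i j → Adj G (f (toℕ i)) (f (toℕ j)) → Adj (pathGraph m) i j
    to i j fi~fj with <-cmp (toℕ i) (toℕ j)
    ... | tri< i<j _ _ = inj₁ (ascending i<j (toℕ≤pred[n] j) fi~fj)
    ... | tri≈ _ i≡j _ = contradiction fi~fj (adj-irrefl G (cong f i≡j))
    ... | tri> _ _ j<i = inj₂ (ascending j<i (toℕ≤pred[n] i) (adj-sym G fi~fj))

    edge : ∀ {i j} → j ≤ m → suc i ≡ j → Adj G (f i) (f j)
    edge j≤m refl = Trace.step trace j≤m

    from : ∀ i j → Adj (pathGraph m) i j → Adj G (f (toℕ i)) (f (toℕ j))
    from i j (inj₁ e) = edge (toℕ≤pred[n] j) e
    from i j (inj₂ e) = adj-sym G (edge (toℕ≤pred[n] i) e)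

  cyclic⊎linear : {f : ℕ → Fin n} → MaximalTrace G m f → IsCycle G ⊎ ∃ λ ℓ → G ≅ pathGraph ℓ
  cyclic⊎linear {m = m} {f = f} max with (2 ≤? m) ×-dec adj? G (f 0) (f m)
  ... | yes (s≤s (s≤s _) , closing) = inj₁ (_ , cyclic max closing)
  ... | no  open-ended              = inj₂ (_ , linear max open-ended)

cycle⊎path : (G : Graph (suc n)) → Connected G → (∀ x → Degree≤ G x 2) →
             IsCycle G ⊎ ∃ λ ℓ → G ≅ pathGraph ℓ
cycle⊎path G connected deg = cyclic⊎linear connected deg (proj₂ (proj₂ (∃maximal G)))

-- Neighbours under isomorphism.

≅-sym : G ≅ H → H ≅ G
≅-sym {G = G} {H = H} iso = record
  { bijection = ↔-sym bijection
  ; adjacency = λ u v → subst₂ (λ u′ v′ → Adj H u′ v′ ⇔ Adj G (from u) (from v))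
      (strictlyInverseˡ u) (strictlyInverseˡ v) (⇔-sym (adjacency _ _))
  }
  where
  open _≅_ iso
  open Inverse bijection using (from; strictlyInverseˡ)

transport : (iso : G ≅ H) → Neighbours G x k → Neighbours H (Inverse.to (_≅_.bijection iso) x) k
transport iso nb = record
  { vertex    = to ∘ vertex
  ; injective = injective ∘ Injection.injective (↔⇒↣ bijection)
  ; adjacent  = λ i → Equivalence.to (adjacency _ _) (adjacent i)
  }
  where
  open _≅_ iso
  open Inverse bijection using (to)
  open Neighbours nb

transport⁻ : (iso : G ≅ H) → Neighbours H (Inverse.to (_≅_.bijection iso) x) k → Neighbours G x k
transport⁻ {G = G} {k = k} iso nb =
  subst (λ x → Neighbours G x k) (Inverse.strictlyInverseʳ (_≅_.bijection iso) _)
    (transport (≅-sym iso) nb)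

-- Degrees in cycles and paths.

cycleSuc-injective : ∀ {i j k} → CycleSuc m i k → CycleSuc m j k → i ≡ j
cycleSuc-injective (inj₁ refl)          (inj₁ refl)          = refl
cycleSuc-injective (inj₁ refl)          (inj₂ (_ , ()))
cycleSuc-injective (inj₂ (_ , refl))    (inj₁ ())
cycleSuc-injective (inj₂ (refl , refl)) (inj₂ (refl , _))    = refl

-- A neighbour is determined by whether it is the successor or the predecessor of `x`, which gives
-- an injection into `Fin 2`.
cycle-degree≤ : ∀ m x → Degree≤ (cycleGraph m) x 2
cycle-degree≤ m x nb =
  injective⇒≤ {f = side ∘ adjacent} (λ {i} {j} → injective ∘ side-injective (adjacent i) (adjacent j))
  where
  open Neighbours nb

  side : Adj (cycleGraph m) x y → Fin 2
  side (inj₁ _) = zero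
  side (inj₂ _) = suc zero

  side-injective : (e : Adj (cycleGraph m) x y) (e′ : Adj (cycleGraph m) x z) →
                   side e ≡ side e′ → y ≡ z
  side-injective (inj₁ e) (inj₁ e′) _ = toℕ-injective (trans (sym e) e′)
  side-injective (inj₂ e) (inj₂ e′) _ = toℕ-injective
    (cycleSuc-injective {m} (next⇒cycleSuc (toℕ<n _) e) (next⇒cycleSuc (toℕ<n _) e′))

cycle-predecessor : (x : Fin (3 + m)) → ∃ λ (y : Fin (3 + m)) → CycleSuc m (toℕ y) (toℕ x)
cycle-predecessor zero    = fromℕ _ , inj₂ (toℕ-fromℕ _ , refl)
cycle-predecessor (suc x) = inject₁ x , inj₁ (cong suc (toℕ-inject₁ x))

-- Two steps cannot return to the start on a cycle with at least three vertices.
cycleSuc-asym : ∀ {i j} → CycleSuc m i j → ¬ CycleSuc m j i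
cycleSuc-asym (inj₁ refl)        (inj₁ 2+i≡i)        = m≢1+n+m _ (sym 2+i≡i)
cycleSuc-asym (inj₁ refl)        (inj₂ (() , refl))
cycleSuc-asym (inj₂ (refl , refl)) (inj₁ ())
cycleSuc-asym (inj₂ (refl , refl)) (inj₂ (() , _))

cycle-neighbours : ∀ m x → Neighbours (cycleGraph m) x 2
cycle-neighbours m x = neighbours ((succ≢pred ∷ []) ∷ [] ∷ [])
  (inj₁ (sym (toℕ-fromℕ< _)) ∷ inj₂ (cycleSuc⇒next (toℕ<n x) (proj₂ (cycle-predecessor x))) ∷ [])
  where
  succ : Fin (3 + m)
  succ = fromℕ< (m%n<n (suc (toℕ x)) (3 + m))

  pred : Fin (3 + m)
  pred = proj₁ (cycle-predecessor x)

  succ≢pred : succ ≢ pred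
  succ≢pred eq = cycleSuc-asym
    (next⇒cycleSuc (toℕ<n x) (trans (sym (toℕ-fromℕ< _)) (cong toℕ eq)))
    (proj₂ (cycle-predecessor x))

unique-neighbour⇒degree≤1 : (∀ {y z} → Adj G x y → Adj G x z → y ≡ z) → Degree≤ G x 1
unique-neighbour⇒degree≤1 unique nb = injective⇒≤ {f = λ _ → zero {0}}
  (λ {i} {j} _ → injective (unique (adjacent i) (adjacent j)))
  where open Neighbours nb

-- Neighbours on the same side coincide, and an end lacks one side: 0 is no successor, and `suc ℓ`
-- is out of range.
path-end-degree≤1 : ∀ {ℓ} {x} → toℕ x ≡ 0 ⊎ toℕ x ≡ ℓ → Degree≤ (pathGraph ℓ) x 1
path-end-degree≤1 {ℓ} {x} end = unique-neighbour⇒degree≤1 (λ {y} {z} → unique end)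
  where
  unique : toℕ x ≡ 0 ⊎ toℕ x ≡ ℓ →
           ∀ {y z} → Adj (pathGraph ℓ) x y → Adj (pathGraph ℓ) x z → y ≡ z
  unique _          (inj₁ e) (inj₁ e′) = toℕ-injective (trans (sym e) e′)
  unique _          (inj₂ e) (inj₂ e′) = toℕ-injective (suc-injective (trans e (sym e′)))
  unique (inj₁ x≡0) (inj₂ e) _         = contradiction (trans e x≡0) λ ()
  unique (inj₁ x≡0) _        (inj₂ e)  = contradiction (trans e x≡0) λ ()
  unique (inj₂ x≡ℓ) {y = y} (inj₁ e) _ =
    contradiction (trans (sym e) (cong suc x≡ℓ)) (<⇒≢ (toℕ<n y))
  unique (inj₂ x≡ℓ) {z = z} _ (inj₁ e) =
    contradiction (trans (sym e) (cong suc x≡ℓ)) (<⇒≢ (toℕ<n z))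

-- With at most one edge, every vertex is an end.
short-path-degree≤1 : ∀ {ℓ} → ℓ ≤ 1 → ∀ x → Degree≤ (pathGraph ℓ) x 1
short-path-degree≤1 ℓ≤1 x = path-end-degree≤1 (end ℓ≤1 (toℕ≤pred[n] x))
  where
  end : ∀ {i ℓ} → ℓ ≤ 1 → i ≤ ℓ → i ≡ 0 ⊎ i ≡ ℓ
  end _         z≤n       = inj₁ refl
  end (s≤s z≤n) (s≤s z≤n) = inj₂ refl

-- From degrees to `vp` and `vp⁻`.

p≤vp : (G : Graph (suc n)) → ∀ x → p G x ≤ vp G
p≤vp G x = All.lookup (xs≤max (p G zero) _) (∈-map⁺ (p G) (∈-allFin x))

vp⁻≤p : (G : Graph (suc n)) → ∀ x → vp⁻ G ≤ p G x
vp⁻≤p G x = All.lookup (min≤xs (p G zero) _) (∈-map⁺ (p G) (∈-allFin x))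

vp≤ : (G : Graph (suc n)) → (∀ x → p G x ≤ d) → vp G ≤ d
vp≤ G bound = max≤v⁺ {xs = map (p G) (allFin _)} (bound zero)
  (All-map⁺ (All.tabulate λ {x} _ → bound x))

≤vp⁻ : (G : Graph (suc n)) → (∀ x → d ≤ p G x) → d ≤ vp⁻ G
≤vp⁻ G bound = v≤min⁺ {xs = map (p G) (allFin _)} (bound zero)
  (All-map⁺ (All.tabulate λ {x} _ → bound x))

module _ (G : Graph (suc n)) (connected : Connected G) where

  -- All degrees are exactly two, so every `p G x` is 2.
  cycle⇒vp⁻≡vp≡2 : IsCycle G → vp⁻ G ≡ vp G × vp G ≡ 2
  cycle⇒vp⁻≡vp≡2 (m , iso) = trans vp⁻≡2 (sym vp≡2) , vp≡2
    where
    deg : ∀ x → Degree≤ G x 2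
    deg x nb = cycle-degree≤ m _ (transport iso nb)

    2≤p : ∀ x → 2 ≤ p G x
    2≤p x = degree≤p (transport⁻ iso (cycle-neighbours m _))

    p≤2 : ∀ x → p G x ≤ 2
    p≤2 x = p≤degree connected deg (deg x) (s≤s z≤n)

    vp≡2 : vp G ≡ 2
    vp≡2 = ≤-antisym (vp≤ G p≤2) (≤-trans (2≤p zero) (p≤vp G zero))

    vp⁻≡2 : vp⁻ G ≡ 2
    vp⁻≡2 = ≤-antisym (≤-trans (vp⁻≤p G zero) (p≤2 zero)) (≤vp⁻ G 2≤p)

  module _ (vp≡2 : vp G ≡ 2) where

    vp≡2⇒degree≤2 : ∀ x → Degree≤ G x 2
    vp≡2⇒degree≤2 x nb = ≤-trans (degree≤p nb) (≤-trans (p≤vp G x) (≤-reflexive vp≡2))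

    -- On a path with at most one edge, every `p G x` is at most 1.
    vp≡2⇒long-path : (∃ λ ℓ → G ≅ pathGraph ℓ) → IsPathOfLength≥2 G
    vp≡2⇒long-path (ℓ , iso) = ℓ , ≰⇒> not-short , iso
      where
      not-short : ¬ (ℓ ≤ 1)
      not-short ℓ≤1 = <⇒≱ {1} {2} ≤-refl (subst (_≤ 1) vp≡2 (vp≤ G λ x →
        p≤degree connected vp≡2⇒degree≤2
          (λ nb → short-path-degree≤1 ℓ≤1 _ (transport iso nb)) ≤-refl))

    vp≡2⇒cycle⊎path : IsCycle G ⊎ IsPathOfLength≥2 G
    vp≡2⇒cycle⊎path = Sum.map₂ vp≡2⇒long-path (cycle⊎path G connected vp≡2⇒degree≤2)

    -- An end of the path has degree at most 1 and so pulls the minimum down to at most 1.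
    vp⁻≡2⇒¬path : vp⁻ G ≡ 2 → ∀ {ℓ} → ¬ (G ≅ pathGraph ℓ)
    vp⁻≡2⇒¬path vp⁻≡2 iso = <⇒≱ {1} {2} ≤-refl (subst (_≤ 1) vp⁻≡2 (≤-trans (vp⁻≤p G _)
      (p≤degree connected vp≡2⇒degree≤2 end-degree≤1 ≤-refl)))
      where
      open Inverse (_≅_.bijection iso) using (from; strictlyInverseˡ)

      end-degree≤1 : Degree≤ G (from zero) 1
      end-degree≤1 nb =
        path-end-degree≤1 (inj₁ (cong toℕ (strictlyInverseˡ zero))) (transport iso nb)

    vp⁻≡2⇒cycle : vp⁻ G ≡ 2 → IsCycle G
    vp⁻≡2⇒cycle vp⁻≡2 = Sum.fromInj₁
      (λ (_ , iso) → contradiction iso (vp⁻≡2⇒¬path vp⁻≡2)) (cycle⊎path G connected vp≡2⇒degree≤2)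

corollary4p2 : ∀ (n : ℕ) (G : Graph (suc n)) → Connected G →
    ((vp⁻ G ≡ vp G × vp G ≡ 2) ⇔ IsCycle G)
    × (vp G ≡ 2 → IsCycle G ⊎ IsPathOfLength≥2 G)
corollary4p2 n G connected =
    mk⇔ (λ (vp⁻≡vp , vp≡2) → vp⁻≡2⇒cycle G connected vp≡2 (trans vp⁻≡vp vp≡2))
        (cycle⇒vp⁻≡vp≡2 G connected)
  , vp≡2⇒cycle⊎path G connected
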